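{- Let $n$ be a positive integer and let $G$ be an oriented graph with at most $n^2 \log n$ edges. Then the edges of $G$ can be coloured with $2$ colours such that every monochromatic directed path in $G$ has length at most $169\, n$.
   Context: Graphs are finite. An oriented graph is a directed graph without loops such that for every two vertices $x, y$ at most one of $xy$ and $yx$ is an edge. A directed path is a sequence of distinct vertices $v_0, v_1, \ldots, v_\ell$ such that $v_{i-1}v_i$ is an edge for each $1 \le i \le \ell$; its length is its number of edges $\ell$. It is monochromatic if all its edges have the same colour. All logarithms are in base $2$. -}

module Defs where

open import Data.Bool using (Bool; T; T?)
open import Data.Fin using (Fin; suc; inject₁)
open import Data.List using (length; filter; cartesianProduct; allFin)
open import Data.Nat using (ℕ; suc; _≤_; _^_; NonZero)
open import Data.Product using (_,_)
open import Function.Definitions using (Injective)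
open import Relation.Binary.Core using (Rel)
open import Relation.Binary.Definitions using (Irreflexive; Asymmetric)
open import Relation.Binary.PropositionalEquality using (_≡_)
open import Level using (0ℓ)

-- The Boolean adjacency matrix makes x ⟶ y decidable and proof-irrelevant,
-- so each ordered pair carries at most one edge.
record OrientedGraph : Set where
  field
    order : ℕ
    adj   : Fin order → Fin order → Bool

  Vertex : Set
  Vertex = Fin order

  infix 4 _⟶_
  _⟶_ : Rel Vertex 0ℓ
  x ⟶ y = T (adj x y)

  field
    loopless : Irreflexive _≡_ _⟶_
    oriented : Asymmetric _⟶_

  edgeCount : ℕ
  edgeCount =
    length (filter (λ (x , y) → T? (adj x y))
                   (cartesianProduct (allFin order) (allFin order)))

-- The real inequality m ≤ k log₂ n, for n ≥ 1, with both sides exponentiated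
-- to base 2.  No rounding of the logarithm is involved.
infix 4 _≤_·log₂_
_≤_·log₂_ : (m k n : ℕ) → .{{NonZero n}} → Set
m ≤ k ·log₂ n = 2 ^ m ≤ n ^ k

module _ (G : OrientedGraph) where
  open OrientedGraph G using (Vertex; _⟶_)

  EdgeColouring : ℕ → Set
  EdgeColouring c = ∀ {x y} → x ⟶ y → Fin c

  record DirectedPath (ℓ : ℕ) : Set where
    field
      vertex   : Fin (suc ℓ) → Vertex
      distinct : Injective _≡_ _≡_ vertex
      edge     : ∀ (i : Fin ℓ) → vertex (inject₁ i) ⟶ vertex (suc i)

  Monochromatic : ∀ {c ℓ} → EdgeColouring c → DirectedPath ℓ → Set
  Monochromatic χ P = ∀ i j → χ (edge i) ≡ χ (edge j)
    where open DirectedPath P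

{-# OPTIONS --safe #-}

-- Order the vertices in classes, each acyclic with at most s² levels, where s² is
-- about (log n)/5.  Colour an edge between classes red if it goes forward and blue
-- if it goes backward, and an edge inside a class according to whether it raises
-- the leading base-s digit of the level.  A monochromatic path then meets each
-- class in at most s vertices, so it suffices to use O(n / s) classes, apart from
-- n independent sets for the vertices of degree below n and at most n singletons.
--
-- The remaining vertices are treated by thresholds s n / 4ʳ on the degree, for r
-- from s down to 0.  While at least 40 n s 4ʳ vertices below the threshold are
-- left, the exchange argument of Erdős and Szemerédi finds a class of 8 s² 8ʳ of
-- them; since n² log n edges leave only 40 n s 4ʳ vertices above the threshold,
-- the costs at the various r form a geometric series.
module Submission where

open import Defs
open import Algebra.Properties.Semiring.Sum as SemiringSum using ()
open import Data.Bool using (Bool; true; false; T; T?; not; _∧_; _∨_; if_then_else_)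
open import Data.Fin using (Fin; zero; suc; toℕ; inject₁; fromℕ)
open import Data.Fin.Properties using (_≟_; toℕ<n; toℕ-injective)
open import Data.List using (length; filter; map; tabulate; cartesianProduct; _++_)
open import Data.List.Properties using (filter-++; length-++)
open import Data.Nat hiding (_≟_)
open import Data.Nat.DivMod using (m≡m%n+[m/n]*n; m%n<n; m<n*o⇒m/o<n)
open import Data.Nat.Properties hiding (_≟_)
open import Data.Nat.Tactic.RingSolver using (solve-∀)
open import Data.Product using (Σ; ∃; ∃₂; _×_; _,_; proj₁; proj₂)
open import Data.Sum using (_⊎_; inj₁; inj₂; [_,_]′)
open import Function using (_∘_)
open import Relation.Binary using (tri<; tri≈; tri>)
open import Relation.Binary.PropositionalEquality
  using (_≡_; _≢_; refl; sym; trans; cong; cong₂; subst)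
open import Relation.Nullary using (¬_; yes; no; does; contradiction)

open SemiringSum +-*-semiring using (sum; sum-cong-≗; ∑-distrib-+; ∑-comm; *-distribˡ-sum)
open ≤-Reasoning

-- Integer inequalities and sums of binomial coefficients

bracket : ∀ (g : ℕ → ℕ) {x} b → g 0 ≤ x → x < g b → ∃ λ s → g s ≤ x × x < g (suc s)
bracket g zero    g₀≤x x<g₀ = contradiction (≤-<-trans g₀≤x x<g₀) (<-irrefl refl)
bracket g {x} (suc b) g₀≤x x<gb with g b ≤? x
... | yes gb≤x = b , gb≤x , x<gb
... | no  gb≰x = bracket g b g₀≤x (≰⇒> gb≰x)

n<2^n : ∀ n → n < 2 ^ n
n<2^n zero    = s≤s z≤n
n<2^n (suc n) = begin-strict
  1 + n           <⟨ +-mono-≤-< (m^n>0 2 n) (n<2^n n) ⟩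
  2 ^ n + 2 ^ n   ≡⟨ cong (2 ^ n +_) (+-identityʳ (2 ^ n)) ⟨
  2 ^ suc n       ∎

2^-cancel-≤ : ∀ {i j} → 2 ^ i ≤ 2 ^ j → i ≤ j
2^-cancel-≤ {i} {j} le with i ≤? j
... | yes i≤j = i≤j
... | no  i≰j = contradiction (^-monoʳ-< 2 (s≤s (s≤s z≤n)) (≰⇒> i≰j)) (≤⇒≯ le)

-- Failure of both alternatives would make the left side at least u + v + 2. The spare unit pays for
-- the vertex set aside in `acyclic-subset`.
+-split-≤ : ∀ {x y} u v → x + y ≤ suc (u + v) → x ≤ u ⊎ y ≤ v
+-split-≤ {x} {y} u v le with x ≤? u | y ≤? v
... | yes x≤u | _       = inj₁ x≤u
... | no  _   | yes y≤v = inj₂ y≤v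
... | no  x≰u | no  y≰v = contradiction le (<⇒≱ (begin-strict
  suc (u + v)    <⟨ ≤-reflexive (cong suc (sym (+-suc u v))) ⟩
  suc u + suc v  ≤⟨ +-mono-≤ (≰⇒> x≰u) (≰⇒> y≰v) ⟩
  x + y          ∎))

-- Bernoulli's inequality (1 + 1/m)ʲ ≤ m / (m − j), with m = j + i.
bernoulli : ∀ m j i → j + i ≡ m → suc m ^ j * i ≤ m ^ suc j
bernoulli m zero    i refl = ≤-reflexive (solve-eq i)
  where
  solve-eq : ∀ i → 1 * i ≡ i * 1
  solve-eq = solve-∀
bernoulli m (suc j) i refl = begin
  suc m * suc m ^ j * i        ≡⟨ shuffle (suc m ^ j) j i ⟩
  suc m ^ j * (suc m * i)      ≤⟨ *-monoʳ-≤ (suc m ^ j) drop ⟩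
  suc m ^ j * (suc i * m)      ≡⟨ *-assoc (suc m ^ j) (suc i) m ⟨
  suc m ^ j * suc i * m        ≤⟨ *-monoˡ-≤ m (bernoulli m j (suc i) (+-suc j i)) ⟩
  m ^ suc j * m                ≡⟨ *-comm (m ^ suc j) m ⟩
  m ^ suc (suc j)              ∎
  where
  shuffle : ∀ x j i → (2 + j + i) * x * i ≡ x * ((2 + j + i) * i)
  shuffle = solve-∀
  expand : ∀ j i → (1 + i) * (1 + j + i) ≡ (2 + j + i) * i + (1 + j)
  expand = solve-∀
  drop : (2 + j + i) * i ≤ (1 + i) * (1 + j + i)
  drop = ≤-trans (m≤m+n _ (1 + j)) (≤-reflexive (sym (expand j i)))

-- For even m = 2q, `bernoulli` with exponent q gives (1 + 1/m)^q ≤ 2, and squaring finishes.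
[1+1/m]^m≤4 : ∀ q → suc (q + q) ^ (q + q) ≤ 4 * (q + q) ^ (q + q)
[1+1/m]^m≤4 zero = s≤s z≤n
[1+1/m]^m≤4 q@(suc _) = begin
  suc m ^ (q + q)                ≡⟨ ^-distribˡ-+-* (suc m) q q ⟩
  suc m ^ q * suc m ^ q          ≤⟨ *-mono-≤ half half ⟩
  (2 * m ^ q) * (2 * m ^ q)      ≡⟨ regroup (m ^ q) ⟩
  4 * (m ^ q * m ^ q)            ≡⟨ cong (4 *_) (^-distribˡ-+-* m q q) ⟨
  4 * m ^ (q + q)                ∎
  where
  m = q + q
  regroup : ∀ x → (2 * x) * (2 * x) ≡ 4 * (x * x)
  regroup = solve-∀
  double : ∀ q x → (q + q) * x ≡ 2 * x * q
  double = solve-∀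
  half : suc m ^ q ≤ 2 * m ^ q
  half = *-cancelʳ-≤ _ _ q (≤-trans (bernoulli m q q refl) (≤-reflexive (double q (m ^ q))))

-- The number of subsets with at most d elements of a set with a elements.
choose≤ : ℕ → ℕ → ℕ
choose≤ zero    d       = 1
choose≤ (suc a) zero    = choose≤ a zero
choose≤ (suc a) (suc d) = choose≤ a d + choose≤ a (suc d)

choose≤-step : ∀ a d → choose≤ a d ≤ choose≤ (suc a) d
choose≤-step a zero    = ≤-refl
choose≤-step a (suc d) = m≤n+m _ _

choose≤-mono : ∀ {a b} d → a ≤ b → choose≤ a d ≤ choose≤ b d
choose≤-mono d a≤b = go (≤⇒≤′ a≤b)
  where
  go : ∀ {a b} → a ≤′ b → choose≤ a d ≤ choose≤ b d
  go ≤′-refl     = ≤-refl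
  go (≤′-step p) = ≤-trans (go p) (choose≤-step _ d)

-- Weighting each C(a, i) with i ≤ d by m^(d - i) and summing by the binomial theorem gives m^d (1 +
-- 1/m)^a. The induction does this through Pascal's rule, with the denominator `m ^ a` cleared.
choose≤-bound : ∀ m .{{_ : NonZero m}} a d → choose≤ a d * m ^ a ≤ m ^ d * suc m ^ a
choose≤-bound m zero    d       = begin
  1 * 1        ≤⟨ m^n>0 m d ⟩
  m ^ d        ≡⟨ *-identityʳ _ ⟨
  m ^ d * 1    ∎
choose≤-bound m (suc a) zero    = begin
  choose≤ a 0 * (m * m ^ a)     ≡⟨ pull (choose≤ a 0) m (m ^ a) ⟩
  m * (choose≤ a 0 * m ^ a)     ≤⟨ *-mono-≤ (n≤1+n m) (choose≤-bound m a 0) ⟩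
  suc m * (1 * suc m ^ a)       ≡⟨ pull 1 (suc m) (suc m ^ a) ⟨
  1 * (suc m * suc m ^ a)       ∎
  where
  pull : ∀ c x y → c * (x * y) ≡ x * (c * y)
  pull = solve-∀
choose≤-bound m (suc a) (suc d) = begin
  (choose≤ a d + choose≤ a (suc d)) * (m * m ^ a)
    ≡⟨ split (choose≤ a d) (choose≤ a (suc d)) m (m ^ a) ⟩
  m * (choose≤ a d * m ^ a) + m * (choose≤ a (suc d) * m ^ a)
    ≤⟨ +-mono-≤ (*-monoʳ-≤ m (choose≤-bound m a d)) (*-monoʳ-≤ m (choose≤-bound m a (suc d))) ⟩
  m * (m ^ d * suc m ^ a) + m * (m * m ^ d * suc m ^ a)
    ≡⟨ merge m (m ^ d) (suc m ^ a) ⟩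
  m * m ^ d * (suc m * suc m ^ a)
    ∎
  where
  split : ∀ x y m z → (x + y) * (m * z) ≡ m * (x * z) + m * (y * z)
  split = solve-∀
  merge : ∀ m x y → m * (x * y) + m * (m * x * y) ≡ m * x * ((1 + m) * y)
  merge = solve-∀

^-distribʳ-* : ∀ x y n → (x * y) ^ n ≡ x ^ n * y ^ n
^-distribʳ-* x y zero    = refl
^-distribʳ-* x y (suc n) =
  trans (cong (x * y *_) (^-distribʳ-* x y n)) (interchange x y (x ^ n) (y ^ n))
  where
  interchange : ∀ x y u v → x * y * (u * v) ≡ (x * u) * (y * v)
  interchange = solve-∀

choose≤-≤ : ∀ q .{{_ : NonZero q}} b d → choose≤ ((q + q) * b) d ≤ (q + q) ^ d * 4 ^ b
choose≤-≤ q@(suc _) b d = *-cancelʳ-≤ _ _ (m ^ (m * b)) {{m^n≢0 m (m * b)}} (begin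
  choose≤ (m * b) d * m ^ (m * b)      ≤⟨ choose≤-bound m (m * b) d ⟩
  m ^ d * suc m ^ (m * b)              ≡⟨ cong (m ^ d *_) (^-*-assoc (suc m) m b) ⟨
  m ^ d * (suc m ^ m) ^ b              ≤⟨ *-monoʳ-≤ (m ^ d) (^-monoˡ-≤ b ([1+1/m]^m≤4 q)) ⟩
  m ^ d * (4 * m ^ m) ^ b              ≡⟨ cong (m ^ d *_) (^-distribʳ-* 4 (m ^ m) b) ⟩
  m ^ d * (4 ^ b * (m ^ m) ^ b)        ≡⟨ cong (λ z → m ^ d * (4 ^ b * z)) (^-*-assoc m m b) ⟩
  m ^ d * (4 ^ b * m ^ (m * b))        ≡⟨ *-assoc (m ^ d) (4 ^ b) _ ⟨
  m ^ d * 4 ^ b * m ^ (m * b)          ∎)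
  where m = q + q

-- Counts the possible traces of at most `d` vertices on a class of the size wanted at threshold
-- `r`. As 8 · 8^r = 2^(3(r + 1)) and r + 1 ≤ 2^r, the factor m^d is at most 2^(3 · 2^r · d), hence
-- at most 2^(2b).
choose≤-2^ : ∀ r b d → 2 * 2 ^ r * d ≤ b →
             choose≤ (8 * (2 ^ r * 2 ^ r * 2 ^ r) * b) d ≤ 2 ^ (4 * b)
choose≤-2^ r b d 2pd≤b = begin
  choose≤ (8 * (p * p * p) * b) d      ≡⟨ cong (λ m → choose≤ (m * b) d) (double (p * p * p)) ⟩
  choose≤ ((q + q) * b) d              ≤⟨ choose≤-≤ q {{m*n≢0 4 (p * p * p)}} b d ⟩
  (q + q) ^ d * 4 ^ b                  ≡⟨ cong₂ (λ m x → m ^ d * x) power (^-*-assoc 2 2 b) ⟩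
  (2 ^ (3 * suc r)) ^ d * 2 ^ (2 * b)  ≡⟨ cong (_* 2 ^ (2 * b)) (^-*-assoc 2 (3 * suc r) d) ⟩
  2 ^ (3 * suc r * d) * 2 ^ (2 * b)    ≡⟨ ^-distribˡ-+-* 2 (3 * suc r * d) (2 * b) ⟨
  2 ^ (3 * suc r * d + 2 * b)          ≤⟨ ^-monoʳ-≤ 2 exponent ⟩
  2 ^ (4 * b)                          ∎
  where
  p = 2 ^ r
  q = 4 * (p * p * p)
  instance
    p≢0 : NonZero p
    p≢0 = m^n≢0 2 r
    pp≢0 : NonZero (p * p)
    pp≢0 = m*n≢0 p p
    ppp≢0 : NonZero (p * p * p)
    ppp≢0 = m*n≢0 (p * p) p
  double : ∀ x → 8 * x ≡ 4 * x + 4 * x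
  double = solve-∀
  power : q + q ≡ 2 ^ (3 * suc r)
  power = trans (cube p) (trans (^-*-assoc 2 (suc r) 3) (cong (2 ^_) (*-comm (suc r) 3)))
    where
    cube : ∀ p → 4 * (p * p * p) + 4 * (p * p * p) ≡ 2 * p * (2 * p * (2 * p * 1))
    cube = solve-∀
  widen : ∀ p d → 3 * p * d + p * d ≡ 2 * (2 * p * d)
  widen = solve-∀
  exponent : 3 * suc r * d + 2 * b ≤ 4 * b
  exponent = begin
    3 * suc r * d + 2 * b            ≤⟨ +-monoˡ-≤ (2 * b) (*-monoˡ-≤ d (*-monoʳ-≤ 3 (n<2^n r))) ⟩
    3 * p * d + 2 * b                ≤⟨ +-monoˡ-≤ (2 * b) (m≤m+n (3 * p * d) (p * d)) ⟩
    3 * p * d + p * d + 2 * b        ≡⟨ cong (_+ 2 * b) (widen p d) ⟩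
    2 * (2 * p * d) + 2 * b          ≤⟨ +-monoˡ-≤ (2 * b) (*-monoʳ-≤ 2 2pd≤b) ⟩
    2 * b + 2 * b                    ≡⟨ *-distribʳ-+ b 2 2 ⟨
    4 * b                            ∎

-- Cardinalities of finite sets

sum-mono-≤ : ∀ {k} {f g : Fin k → ℕ} → (∀ i → f i ≤ g i) → sum f ≤ sum g
sum-mono-≤ {zero}  f≤g = z≤n
sum-mono-≤ {suc k} f≤g = +-mono-≤ (f≤g zero) (sum-mono-≤ (f≤g ∘ suc))

sum-+-≤ : ∀ {k} (f g h : Fin k → ℕ) → (∀ i → f i ≤ g i + h i) → sum f ≤ sum g + sum h
sum-+-≤ f g h f≤g+h = ≤-trans (sum-mono-≤ f≤g+h) (≤-reflexive (∑-distrib-+ g h))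

sum-zero : ∀ k → sum {k} (λ _ → 0) ≡ 0
sum-zero zero    = refl
sum-zero (suc k) = sum-zero k

sum-<⇒∃0 : ∀ {k} (f : Fin k → ℕ) → sum f < k → ∃ λ i → f i ≡ 0
sum-<⇒∃0 {suc k} f Σf<k with f zero in eq
... | zero  = zero , eq
... | suc x with i , fi≡0 ← sum-<⇒∃0 (f ∘ suc) (≤-<-trans (m≤n+m _ x) (s≤s⁻¹ Σf<k)) = suc i , fi≡0

sum-0<⇒∃0< : ∀ {k} (f : Fin k → ℕ) → 0 < sum f → ∃ λ i → 0 < f i
sum-0<⇒∃0< {suc k} f 0<Σf with f zero in eq
... | suc x = zero , subst (0 <_) (sym eq) (s≤s z≤n)
... | zero with i , 0<fi ← sum-0<⇒∃0< (f ∘ suc) 0<Σf = suc i , 0<fi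

term≤sum : ∀ {k} (f : Fin k → ℕ) i → f i ≤ sum f
term≤sum f zero    = m≤m+n _ _
term≤sum f (suc i) = ≤-trans (term≤sum (f ∘ suc) i) (m≤n+m _ _)

ind : Bool → ℕ
ind b = if b then 1 else 0

ind-T : ∀ {b} → T b → ind b ≡ 1
ind-T {true} _ = refl

ind-mono : ∀ {b c} → (T b → T c) → ind b ≤ ind c
ind-mono {false}        _ = z≤n
ind-mono {true} {true}  _ = s≤s z≤n
ind-mono {true} {false} f = contradiction (f _) λ ()

sum-singleton : ∀ {k} (v : Fin k) → sum (λ w → ind (does (w ≟ v))) ≡ 1
sum-singleton {suc k} zero    = cong suc (sum-zero k)
sum-singleton {suc k} (suc v) = sum-singleton v

Subset : ℕ → Set
Subset k = Fin k → Bool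

card : ∀ {k} → Subset k → ℕ
card P = sum (ind ∘ P)

infix 4 _⊆_
_⊆_ : ∀ {k} → Subset k → Subset k → Set
P ⊆ Q = ∀ v → T (P v) → T (Q v)

infixr 6 _∪_
infixr 7 _∩_ _∖_
_∪_ _∩_ _∖_ : ∀ {k} → Subset k → Subset k → Subset k
(P ∪ Q) v = P v ∨ Q v
(P ∩ Q) v = P v ∧ Q v
(P ∖ Q) v = P v ∧ not (Q v)

⁅_⁆ : ∀ {k} → Fin k → Subset k
⁅ v ⁆ w = does (w ≟ v)

∧⁻ : ∀ b c → T (b ∧ c) → T b × T c
∧⁻ true c t = _ , t

∧⁺ : ∀ b c → T b → T c → T (b ∧ c)
∧⁺ true c _ t = t

∨⁻ : ∀ b c → T (b ∨ c) → T b ⊎ T c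
∨⁻ true  c t = inj₁ t
∨⁻ false c t = inj₂ t

∨⁺ʳ : ∀ b c → T c → T (b ∨ c)
∨⁺ʳ true  c t = _
∨⁺ʳ false c t = t

∨⁺ˡ : ∀ b c → T b → T (b ∨ c)
∨⁺ˡ true c t = _

not⁻ : ∀ b → T (not b) → ¬ T b
not⁻ false _ ()

not⁺ : ∀ b → ¬ T b → T (not b)
not⁺ true  ¬t = ¬t _
not⁺ false _  = _

card-mono : ∀ {k} (P Q : Subset k) → P ⊆ Q → card P ≤ card Q
card-mono P Q P⊆Q = sum-mono-≤ (λ v → ind-mono (P⊆Q v))

card-split : ∀ {k} (P Q : Subset k) → card P ≡ card (P ∩ Q) + card (P ∖ Q)
card-split P Q = trans (sum-cong-≗ λ v → split (P v) (Q v)) (∑-distrib-+ (ind ∘ (P ∩ Q)) (ind ∘ (P ∖ Q)))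
  where
  split : ∀ b c → ind b ≡ ind (b ∧ c) + ind (b ∧ not c)
  split false c     = refl
  split true  false = refl
  split true  true  = refl

card-∪-disjoint : ∀ {k} (P Q : Subset k) → (∀ v → T (P v) → ¬ T (Q v)) → card (P ∪ Q) ≡ card P + card Q
card-∪-disjoint P Q disj = trans (sum-cong-≗ λ v → join (P v) (Q v) (disj v)) (∑-distrib-+ (ind ∘ P) (ind ∘ Q))
  where
  join : ∀ b c → (T b → ¬ T c) → ind (b ∨ c) ≡ ind b + ind c
  join false c     _ = refl
  join true  false _ = refl
  join true  true  d = contradiction _ (d _)

card-∖ : ∀ {k} (P Q : Subset k) → Q ⊆ P → card P ≡ card Q + card (P ∖ Q)
card-∖ P Q Q⊆P = trans (sum-cong-≗ λ v → split (P v) (Q v) (Q⊆P v)) (∑-distrib-+ (ind ∘ Q) (ind ∘ (P ∖ Q)))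
  where
  split : ∀ b c → (T c → T b) → ind b ≡ ind c + ind (b ∧ not c)
  split false false _ = refl
  split false true  f = contradiction (f _) λ ()
  split true  false _ = refl
  split true  true  _ = refl

element : ∀ {k} (P : Subset k) → 0 < card P → ∃ λ v → T (P v)
element P 0<P with v , 0<Pv ← sum-0<⇒∃0< (ind ∘ P) 0<P = v , positive (P v) 0<Pv
  where
  positive : ∀ b → 0 < ind b → T b
  positive true _ = _

T⇒≡true : ∀ {b} → T b → b ≡ true
T⇒≡true {true} _ = refl

¬T⇒≡false : ∀ {b} → ¬ T b → b ≡ false
¬T⇒≡false {true}  ¬t = contradiction _ ¬t
¬T⇒≡false {false} _  = refl

card-exchange : ∀ {k} (A S B : Subset k) → (∀ v → T (B v) → ¬ T (A v)) → card (A ∩ S) < card B →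
  card A < card (A ∖ S ∪ B)
card-exchange A S B disj S<B = begin-strict
  card A                         ≡⟨ card-split A S ⟩
  card (A ∩ S) + card (A ∖ S)    <⟨ +-monoˡ-< (card (A ∖ S)) S<B ⟩
  card B + card (A ∖ S)          ≡⟨ +-comm (card B) _ ⟩
  card (A ∖ S) + card B          ≡⟨ card-∪-disjoint (A ∖ S) B
                                      (λ v t Bv → disj v Bv (proj₁ (∧⁻ (A v) _ t))) ⟨
  card (A ∖ S ∪ B)               ∎

-- Split W by one set E i at a time: Pascal's rule for choose≤ says that one of
-- the two parts is large enough to continue with.
common-trace : ∀ {k l} (A : Subset k) (E : Fin k → Subset l) d M (W : Subset l) →
  (∀ w → T (W w) → sum (λ i → ind (A i ∧ E i w)) ≤ d) →
  M * choose≤ (card A) d ≤ card W →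
  ∃ λ W′ → W′ ⊆ W × M ≤ card W′ ×
    (∀ i → T (A i) → ∀ v w → T (W′ v) → T (W′ w) → E i v ≡ E i w)
common-trace {zero} A E d M W few large =
  W , (λ _ t → t) , subst (_≤ card W) (*-identityʳ M) large , λ ()
common-trace {suc k} A E d M W few large with A zero in A₀
... | false with W′ , W′⊆W , M≤W′ , const ← common-trace (A ∘ suc) (E ∘ suc) d M W few large =
  W′ , W′⊆W , M≤W′ , λ where
    zero    t → contradiction (subst T A₀ t) λ ()
    (suc i)   → const i
common-trace {suc k} A E zero M W few large | true
  with W′ , W′⊆W , M≤W′ , const ← common-trace (A ∘ suc) (E ∘ suc) zero M W
         (λ w Ww → ≤-trans (m≤n+m _ _) (few w Ww)) large =
  W′ , W′⊆W , M≤W′ , λ where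
    zero    _ v w W′v W′w → trans (none v (W′⊆W v W′v)) (sym (none w (W′⊆W w W′w)))
    (suc i)               → const i
  where
  none : ∀ w → T (W w) → E zero w ≡ false
  none w Ww with E zero w | few w Ww
  ... | false | _ = refl
common-trace {suc k} A E (suc d) M W few large | true
  with +-split-≤ (card (W ∩ E zero)) (card (W ∖ E zero)) (m≤n⇒m≤1+n
         (begin
           M * choose≤ a d + M * choose≤ a (suc d)   ≡⟨ *-distribˡ-+ M (choose≤ a d) (choose≤ a (suc d)) ⟨
           M * (choose≤ a d + choose≤ a (suc d))     ≤⟨ large ⟩
           card W                                    ≡⟨ card-split W (E zero) ⟩
           card (W ∩ E zero) + card (W ∖ E zero)     ∎))
  where a = card (A ∘ suc)
... | inj₁ large∩ =
  let W′ , W′⊆ , M≤W′ , const = common-trace (A ∘ suc) (E ∘ suc) d M (W ∩ E zero) few∩ large∩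
      W′⊆W w t = proj₁ (∧⁻ (W w) _ (W′⊆ w t))
      E-true w t = T⇒≡true (proj₂ (∧⁻ (W w) _ (W′⊆ w t)))
  in W′ , W′⊆W , M≤W′ , λ where
    zero    _ v w W′v W′w → trans (E-true v W′v) (sym (E-true w W′w))
    (suc i)               → const i
  where
  -- Membership in `E zero` uses up one of the `suc d` incidences, which matches the Pascal term
  -- with `d`.
  few∩ : ∀ w → T ((W ∩ E zero) w) → sum (λ i → ind (A (suc i) ∧ E (suc i) w)) ≤ d
  few∩ w t with Ww , Ew ← ∧⁻ (W w) (E zero w) t =
    s≤s⁻¹ (≤-trans (+-monoˡ-≤ _ (≤-reflexive (sym (ind-T Ew)))) (few w Ww))
... | inj₂ large∖ =
  let W′ , W′⊆ , M≤W′ , const = common-trace (A ∘ suc) (E ∘ suc) (suc d) M (W ∖ E zero) few∖ large∖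
      W′⊆W w t = proj₁ (∧⁻ (W w) _ (W′⊆ w t))
      E-false w t = ¬T⇒≡false (not⁻ _ (proj₂ (∧⁻ (W w) _ (W′⊆ w t))))
  in W′ , W′⊆W , M≤W′ , λ where
    zero    _ v w W′v W′w → trans (E-false v W′v) (sym (E-false w W′w))
    (suc i)               → const i
  where
  few∖ : ∀ w → T ((W ∖ E zero) w) → sum (λ i → ind (A (suc i) ∧ E (suc i) w)) ≤ suc d
  few∖ w t = ≤-trans (m≤n+m _ _) (few w (proj₁ (∧⁻ (W w) _ t)))

-- The edge count as a double sum, and rising chains

length-filter-tabulate : ∀ {X Y : Set} {k} (p : X × Y → Bool) x (g : Fin k → Y) →
  length (filter (T? ∘ p) (map (x ,_) (tabulate g))) ≡ sum (λ i → ind (p (x , g i)))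
length-filter-tabulate {k = zero}  p x g = refl
length-filter-tabulate {k = suc k} p x g with p (x , g zero)
... | true  = cong suc (length-filter-tabulate p x (g ∘ suc))
... | false = length-filter-tabulate p x (g ∘ suc)

length-filter-product : ∀ {X Y : Set} {k l} (p : X × Y → Bool) (f : Fin k → X) (g : Fin l → Y) →
  length (filter (T? ∘ p) (cartesianProduct (tabulate f) (tabulate g))) ≡
  sum (λ i → sum (λ j → ind (p (f i , g j))))
length-filter-product {k = zero}  p f g = refl
length-filter-product {k = suc k} p f g = begin-equality
  length (filter P? (row ++ rest))                    ≡⟨ cong length (filter-++ P? row rest) ⟩
  length (filter P? row ++ filter P? rest)            ≡⟨ length-++ (filter P? row) ⟩
  length (filter P? row) + length (filter P? rest)
    ≡⟨ cong₂ _+_ (length-filter-tabulate p (f zero) g) (length-filter-product p (f ∘ suc) g) ⟩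
  sum (λ i → sum (λ j → ind (p (f i , g j))))         ∎
  where
  P? = T? ∘ p
  row = map (f zero ,_) (tabulate g)
  rest = cartesianProduct (tabulate (f ∘ suc)) (tabulate g)

chain-length : ∀ ℓ (z : Fin (suc ℓ) → ℕ) → (∀ i → z (inject₁ i) < z (suc i)) → ℓ ≤ z (fromℕ ℓ)
chain-length zero    z rising = z≤n
chain-length ℓ@(suc _) z rising = ≤-trans (m≤n+m ℓ (z zero)) (go ℓ z rising)
  where
  go : ∀ ℓ (z : Fin (suc ℓ) → ℕ) → (∀ i → z (inject₁ i) < z (suc i)) → z zero + ℓ ≤ z (fromℕ ℓ)
  go zero    z rising = ≤-reflexive (+-identityʳ (z zero))
  go (suc ℓ) z rising = begin
    z zero + suc ℓ      ≡⟨ +-suc (z zero) ℓ ⟩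
    suc (z zero) + ℓ    ≤⟨ +-monoˡ-≤ ℓ (rising zero) ⟩
    z (suc zero) + ℓ    ≤⟨ go ℓ (z ∘ suc) (rising ∘ suc) ⟩
    z (fromℕ (suc ℓ))   ∎

-- Layouts and graded sets

module _ (G : OrientedGraph) where
  open OrientedGraph G

  VertexSet : Set
  VertexSet = Subset order

  -- A layout certifies that colouring the edges along which x rises red and the
  -- remaining ones blue leaves at most b vertices on every monochromatic path.
  record Layout (P : VertexSet) (b : ℕ) : Set where
    field
      x y   : Vertex → ℕ
      x<    : ∀ v → T (P v) → x v < b
      y<    : ∀ v → T (P v) → y v < b
      rises : ∀ u v → T (P u) → T (P v) → u ⟶ v → x u < x v ⊎ y u < y v

  -- Only `x` decides the colour. A blue edge does not raise `x`, so `rises` makes it raise `y`; a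
  -- coordinate below `b` can rise along fewer than `b` consecutive edges.
  layout⇒colouring : ∀ {b} → Layout (λ _ → true) b →
    Σ (EdgeColouring G 2) λ χ → ∀ {ℓ} (P : DirectedPath G ℓ) → Monochromatic G χ P → ℓ < b
  layout⇒colouring {b} L = χ , bound
    where
    open Layout L
    χ : EdgeColouring G 2
    χ {u} {v} _ = if x u <ᵇ x v then zero else suc zero
    red : ∀ {u v} (e : u ⟶ v) → χ e ≡ zero → x u < x v
    red {u} {v} e eq with x u <ᵇ x v in lt
    red e eq | true = <ᵇ⇒< _ _ (subst T (sym lt) _)
    red e () | false
    blue : ∀ {u v} (e : u ⟶ v) → χ e ≡ suc zero → y u < y v
    blue {u} {v} e eq with x u <ᵇ x v in lt
    blue e () | true
    blue {u} {v} e eq | false =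
      [ (λ x< → contradiction (subst T lt (<⇒<ᵇ x<)) λ ()) , (λ y< → y<) ]′ (rises u v _ _ e)
    bound : ∀ {ℓ} (P : DirectedPath G ℓ) → Monochromatic G χ P → ℓ < b
    -- A path without edges has no colour; its vertex alone shows 0 < b.
    bound {zero} P _ = ≤-<-trans z≤n (x< (DirectedPath.vertex P zero) _)
    bound {suc ℓ} P mono with χ (DirectedPath.edge P zero) in eq
    ... | zero = ≤-<-trans (chain-length _ (x ∘ vertex) λ i → red (edge i) (trans (mono i zero) eq)) (x< _ _)
      where open DirectedPath P
    ... | suc zero = ≤-<-trans (chain-length _ (y ∘ vertex) λ i → blue (edge i) (trans (mono i zero) eq)) (y< _ _)
      where open DirectedPath P

  layout-⊆ : ∀ {P Q b} → Q ⊆ P → Layout P b → Layout Q b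
  layout-⊆ Q⊆P L = record
    { x     = x
    ; y     = y
    ; x<    = λ v → x< v ∘ Q⊆P v
    ; y<    = λ v → y< v ∘ Q⊆P v
    ; rises = λ u v Qu Qv → rises u v (Q⊆P u Qu) (Q⊆P v Qv)
    }
    where open Layout L

  layout-∅ : ∀ {P} → (∀ v → ¬ T (P v)) → Layout P 0
  layout-∅ empty = record
    { x     = λ _ → 0
    ; y     = λ _ → 0
    ; x<    = λ v Pv → contradiction Pv (empty v)
    ; y<    = λ v Pv → contradiction Pv (empty v)
    ; rises = λ u _ Pu → contradiction Pu (empty u)
    }

  -- Edges from P to Q become red and edges from Q to P blue.
  layout-∪ : ∀ {P Q b c} → Layout P b → Layout Q c → Layout (P ∪ Q) (b + c)
  layout-∪ {P} {Q} {b} {c} L M = record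
    { x = x ; y = y ; x< = x< ; y< = y< ; rises = rises }
    where
    module L = Layout L
    module M = Layout M
    x y : Vertex → ℕ
    x v = if P v then L.x v else b + M.x v
    y v = if P v then c + L.y v else M.y v
    x< : ∀ v → T ((P ∪ Q) v) → x v < b + c
    x< v t with P v | L.x< v
    ... | true  | lt = ≤-trans (lt _) (m≤m+n b c)
    ... | false | _  = +-monoʳ-< b (M.x< v t)
    y< : ∀ v → T ((P ∪ Q) v) → y v < b + c
    y< v t with P v | L.y< v
    ... | true  | lt = subst (c + L.y v <_) (+-comm c b) (+-monoʳ-< c (lt _))
    ... | false | _  = ≤-trans (M.y< v t) (m≤n+m c b)
    rises : ∀ u v → T ((P ∪ Q) u) → T ((P ∪ Q) v) → u ⟶ v → x u < x v ⊎ y u < y v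
    rises u v tu tv e with P u | P v | L.x< u | L.y< v | L.rises u v
    ... | true  | true  | _  | _  | up = [ inj₁ , inj₂ ∘ +-monoʳ-< c ]′ (up _ _ e)
    ... | true  | false | lt | _  | _  = inj₁ (≤-trans (lt _) (m≤m+n b _))
    ... | false | true  | _  | lt | _  = inj₂ (≤-trans (M.y< u tu) (m≤m+n c _))
    ... | false | false | _  | _  | _  = [ inj₁ ∘ +-monoʳ-< b , inj₂ ]′ (M.rises u v tu tv e)

  -- A ranking that certifies acyclicity; `h` bounds the number of vertices on a directed path
  -- inside `P`.
  record Graded (P : VertexSet) (h : ℕ) : Set where
    field
      level  : Vertex → ℕ
      level< : ∀ v → T (P v) → level v < h
      rises  : ∀ u v → T (P u) → T (P v) → u ⟶ v → level u < level v

  -- A level below s² has two digits in base `s`, and a number can only grow if one of its two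
  -- digits grows.
  graded⇒layout : ∀ {P} s .{{_ : NonZero s}} → Graded P (s * s) → Layout P s
  graded⇒layout s A = record
    { x     = λ v → level v / s
    ; y     = λ v → level v % s
    ; x<    = λ v Pv → m<n*o⇒m/o<n (level< v Pv)
    ; y<    = λ v _ → m%n<n (level v) s
    ; rises = λ u v Pu Pv e → digits (level u) (level v) (rises u v Pu Pv e)
    }
    where
    open Graded A
    digits : ∀ i j → i < j → i / s < j / s ⊎ i % s < j % s
    digits i j i<j with i / s <? j / s | i % s <? j % s
    ... | yes lt | _      = inj₁ lt
    ... | no  _  | yes lt = inj₂ lt
    ... | no  q≮ | no  r≮ = contradiction i<j (≤⇒≯ (begin
      j                    ≡⟨ m≡m%n+[m/n]*n j s ⟩
      j % s + j / s * s    ≤⟨ +-mono-≤ (≮⇒≥ r≮) (*-monoˡ-≤ s (≮⇒≥ q≮)) ⟩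
      i % s + i / s * s    ≡⟨ m≡m%n+[m/n]*n i s ⟨
      i                    ∎))

  graded-∅ : ∀ {h} → Graded (λ _ → false) h
  graded-∅ = record { level = λ _ → 0 ; level< = λ _ () ; rises = λ _ _ () }

  -- Since no edge from `P` enters `v`, it can take level 0 once the other levels have moved up by
  -- one.
  graded-bottom : ∀ {P h} v → Graded P h → (∀ w → T (P w) → ¬ w ⟶ v) → Graded (⁅ v ⁆ ∪ P) (suc h)
  graded-bottom {P} {h} v A no-in = record { level = level′ ; level< = level′< ; rises = rises′ }
    where
    open Graded A
    level′ : Vertex → ℕ
    level′ w = if does (w ≟ v) then 0 else suc (level w)
    level′< : ∀ w → T ((⁅ v ⁆ ∪ P) w) → level′ w < suc h
    level′< w t with w ≟ v
    ... | yes _ = s≤s z≤n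
    ... | no  _ = s≤s (level< w t)
    rises′ : ∀ u w → T ((⁅ v ⁆ ∪ P) u) → T ((⁅ v ⁆ ∪ P) w) → u ⟶ w → level′ u < level′ w
    rises′ u w tu tw e with u ≟ v | w ≟ v
    ... | yes refl | yes refl = contradiction e (loopless refl)
    ... | yes refl | no  _    = s≤s z≤n
    ... | no  _    | yes refl = contradiction e (no-in u tu)
    ... | no  _    | no  _    = s≤s (rises u w tu tw e)

  graded-top : ∀ {P h} v → Graded P h → (∀ w → T (P w) → ¬ v ⟶ w) → Graded (⁅ v ⁆ ∪ P) (suc h)
  graded-top {P} {h} v A no-out = record { level = level′ ; level< = level′< ; rises = rises′ }
    where
    open Graded A
    level′ : Vertex → ℕ
    level′ w = if does (w ≟ v) then h else level w
    level′< : ∀ w → T ((⁅ v ⁆ ∪ P) w) → level′ w < suc h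
    level′< w t with w ≟ v
    ... | yes _ = ≤-refl
    ... | no  _ = m≤n⇒m≤1+n (level< w t)
    rises′ : ∀ u w → T ((⁅ v ⁆ ∪ P) u) → T ((⁅ v ⁆ ∪ P) w) → u ⟶ w → level′ u < level′ w
    rises′ u w tu tw e with u ≟ v | w ≟ v
    ... | yes refl | yes refl = contradiction e (loopless refl)
    ... | yes refl | no  _    = contradiction e (no-out w tw)
    ... | no  _    | yes refl = level< u tu
    ... | no  _    | no  _    = rises u w tu tw e

  card-insert : ∀ v (P : VertexSet) → ¬ T (P v) → card (⁅ v ⁆ ∪ P) ≡ suc (card P)
  card-insert v P v∉P = trans (card-∪-disjoint ⁅ v ⁆ P disj) (cong (_+ card P) (sum-singleton v))
    where
    disj : ∀ w → T (does (w ≟ v)) → ¬ T (P w)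
    disj w t Pw with w ≟ v
    ... | yes refl = v∉P Pw

  -- Each w ≠ v misses an edge to or from v, so half of W ∖ {v} can follow or
  -- precede v.
  acyclic-subset : ∀ h W → 2 ^ h ≤ card W → ∃ λ A → A ⊆ W × Graded A h × card A ≡ h
  acyclic-subset zero W _ =
    (λ _ → false) , (λ _ ()) , graded-∅ , sum-zero order
  acyclic-subset (suc h) W large
    with v , Wv ← element W (≤-trans (m^n>0 2 (suc h)) large) =
    -- Without its in-neighbours `v` goes to the bottom, without its out-neighbours to the top.
    [ extend from (graded-bottom v) , extend to (graded-top v) ]′
    (+-split-≤ (card (rest from)) (card (rest to)) half)
    where
    from to : VertexSet
    from w = adj w v
    to w = adj v w
    rest : VertexSet → VertexSet
    rest B = (W ∖ ⁅ v ⁆) ∖ B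
    -- At most one of the edges wv and vw exists, so every w ≠ v of `W` survives the removal of the
    -- in-neighbours or that of the out-neighbours.
    missing : ∀ b c d e → ¬ (T d × T e) →
      ind b ≤ ind c + (ind ((b ∧ not c) ∧ not d) + ind ((b ∧ not c) ∧ not e))
    missing false c     d     e     _ = z≤n
    missing true  true  d     e     _ = s≤s z≤n
    missing true  false false e     _ = s≤s z≤n
    missing true  false true  false _ = s≤s z≤n
    missing true  false true  true  f = contradiction _ f
    half : 2 ^ h + 2 ^ h ≤ suc (card (rest from) + card (rest to))
    half = begin
      2 ^ h + 2 ^ h      ≡⟨ cong (2 ^ h +_) (+-identityʳ (2 ^ h)) ⟨
      2 ^ suc h          ≤⟨ large ⟩
      card W             ≤⟨ sum-+-≤ _ _ _ (λ w → missing (W w) (⁅ v ⁆ w) (from w) (to w)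
                              λ (in-v , out-v) → oriented in-v out-v) ⟩
      card ⁅ v ⁆ + sum (λ w → ind (rest from w) + ind (rest to w))
                         ≡⟨ cong₂ _+_ (sum-singleton v) (∑-distrib-+ (ind ∘ rest from) (ind ∘ rest to)) ⟩
      suc (card (rest from) + card (rest to)) ∎
    extend : ∀ B → (∀ {P} → Graded P h → (∀ w → T (P w) → ¬ T (B w)) → Graded (⁅ v ⁆ ∪ P) (suc h)) →
      2 ^ h ≤ card (rest B) → ∃ λ A → A ⊆ W × Graded A (suc h) × card A ≡ suc h
    extend B insert le with A , A⊆ , gr , eq ← acyclic-subset h (rest B) le =
      ⁅ v ⁆ ∪ A , ⊆W , insert gr (λ w → not⁻ (B w) ∘ proj₂ ∘ inside w) ,
      trans (card-insert v A v∉A) (cong suc eq)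
      where
      inside : ∀ w → T (A w) → T ((W ∖ ⁅ v ⁆) w) × T (not (B w))
      inside w Aw = ∧⁻ ((W ∖ ⁅ v ⁆) w) _ (A⊆ w Aw)
      v∉A : ¬ T (A v)
      v∉A Av with v ≟ v | ∧⁻ (W v) _ (proj₁ (inside v Av))
      ... | yes _  | _ , ()
      ... | no v≢v | _ = v≢v refl
      ⊆W : ⁅ v ⁆ ∪ A ⊆ W
      ⊆W w t with w ≟ v
      ... | yes refl = Wv
      ... | no  _    = proj₁ (∧⁻ (W w) _ (proj₁ (inside w t)))

  -- Neighbourhoods and the exchange argument

  nb : Vertex → Vertex → Bool
  nb u v = adj u v ∨ adj v u

  deg : Vertex → ℕ
  deg u = card (nb u)

  graded-⊆ : ∀ {P Q h} → Q ⊆ P → Graded P h → Graded Q h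
  graded-⊆ Q⊆P A = record
    { level  = level
    ; level< = λ v → level< v ∘ Q⊆P v
    ; rises  = λ u v Qu Qv → rises u v (Q⊆P u Qu) (Q⊆P v Qv)
    }
    where open Graded A

  -- Separated sets can share the same levels, so their heights do not add up.
  graded-∪ : ∀ {P Q h} → Graded P h → Graded Q h → (∀ u v → T (P u) → T (Q v) → ¬ T (nb u v)) →
    Graded (P ∪ Q) h
  graded-∪ {P} {Q} {h} A B separated = record { level = level ; level< = level< ; rises = rises }
    where
    module A = Graded A
    module B = Graded B
    level : Vertex → ℕ
    level v = if P v then A.level v else B.level v
    level< : ∀ v → T ((P ∪ Q) v) → level v < h
    level< v t with P v | A.level< v
    ... | true  | lt = lt _
    ... | false | _  = B.level< v t
    rises : ∀ u v → T ((P ∪ Q) u) → T ((P ∪ Q) v) → u ⟶ v → level u < level v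
    rises u v tu tv e with P u | P v | A.rises u v | separated u v | separated v u
    ... | true  | true  | up | _   | _   = up _ _ e
    ... | true  | false | _  | sep | _   = contradiction (∨⁺ˡ _ _ e) (sep _ tv)
    ... | false | true  | _  | _   | sep = contradiction (∨⁺ʳ (adj v u) _ e) (sep _ tu)
    ... | false | false | _  | _   | _   = B.rises u v tu tv e

  -- Erdős–Szemerédi exchange: if A is too small then many vertices outside A
  -- have few neighbours in A, and pigeonholing their traces on A yields 2^(s²)
  -- of them with the same neighbourhood S in A; an acyclic set of s² of those can
  -- replace S without raising the number of levels.
  module Exchange (n s r : ℕ) .{{_ : NonZero s}}
    (small : s * 2 ^ r ≤ n) (large : 2 ^ (5 * (s * s)) ≤ n)
    (C : VertexSet) (sparse : ∀ v → T (C v) → 2 ^ r * 2 ^ r * deg v ≤ s * n)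
    (many : 40 * (n * s * (2 ^ r * 2 ^ r)) ≤ card C) where

    p h : ℕ
    p = 2 ^ r
    h = s * s

    instance
      p≢0 : NonZero p
      p≢0 = m^n≢0 2 r
      h≢0 : NonZero h
      h≢0 = m*n≢0 s s
      pp≢0 : NonZero (p * p)
      pp≢0 = m*n≢0 p p
      pph≢0 : NonZero (p * p * h)
      pph≢0 = m*n≢0 (p * p) h

    module _ (A : VertexSet) (A⊆C : A ⊆ C) (gr : Graded A h) (A< : card A ≤ 8 * (p * p * p) * h) where

      trace : Vertex → ℕ
      trace w = card (λ u → A u ∧ nb u w)

      -- Double counting of adjacent pairs: every vertex of `A` lies in `C`, hence has degree at
      -- most s n / p².
      trace-sum : p * p * sum trace ≤ card A * (s * n)
      trace-sum = begin
        p * p * sum trace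
          ≡⟨ cong (p * p *_) (∑-comm (λ w u → ind (A u ∧ nb u w))) ⟩
        p * p * sum (λ u → sum (λ w → ind (A u ∧ nb u w)))
          ≡⟨ *-distribˡ-sum (p * p) (λ u → sum (λ w → ind (A u ∧ nb u w))) ⟩
        sum (λ u → p * p * sum (λ w → ind (A u ∧ nb u w)))
          ≤⟨ sum-mono-≤ row ⟩
        sum (λ u → s * n * ind (A u))
          ≡⟨ *-distribˡ-sum (s * n) (ind ∘ A) ⟨
        s * n * card A
          ≡⟨ *-comm (s * n) (card A) ⟩
        card A * (s * n) ∎
        where
        row : ∀ u → p * p * sum (λ w → ind (A u ∧ nb u w)) ≤ s * n * ind (A u)
        row u with A u | A⊆C u
        ... | true  | inC = ≤-trans (sparse u (inC _)) (≤-reflexive (sym (*-identityʳ (s * n))))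
        ... | false | _   = ≤-trans (≤-reflexive (trans (cong (p * p *_) (sum-zero order)) (*-zeroʳ (p * p)))) z≤n

      -- `d` is the integer part of h / (2p). Its being so small limits the number of traces, its
      -- being so large limits `bad`.
      module _ (d : ℕ) (d≤ : 2 * p * d ≤ h) (<d+1 : h < 2 * p * suc d) where

        good bad : VertexSet
        good w = C w ∧ (not (A w) ∧ (trace w ≤ᵇ d))
        bad w = not (trace w ≤ᵇ d)

        -- Markov's inequality: a bad vertex has trace above h / (2p), while all traces add up to at
        -- most |A| s n / p² ≤ 8 p h s n.
        card-bad : card bad ≤ 16 * (n * s * (p * p))
        card-bad = *-cancelʳ-≤ _ _ (p * p * h) (begin
          card bad * (p * p * h)                        ≡⟨ shift (card bad) (p * p) h ⟩
          p * p * (h * card bad)                        ≡⟨ cong (p * p *_) (*-distribˡ-sum h (ind ∘ bad)) ⟩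
          p * p * sum (λ w → h * ind (bad w))           ≤⟨ *-monoʳ-≤ (p * p) (sum-mono-≤ each) ⟩
          p * p * sum (λ w → 2 * p * trace w)           ≡⟨ cong (p * p *_) (*-distribˡ-sum (2 * p) trace) ⟨
          p * p * (2 * p * sum trace)                   ≡⟨ swap (p * p) (2 * p) (sum trace) ⟩
          2 * p * (p * p * sum trace)                   ≤⟨ *-monoʳ-≤ (2 * p) trace-sum ⟩
          2 * p * (card A * (s * n))                    ≤⟨ *-monoʳ-≤ (2 * p) (*-monoˡ-≤ (s * n) A<) ⟩
          2 * p * (8 * (p * p * p) * h * (s * n))       ≡⟨ collect p h s n ⟩
          16 * (n * s * (p * p)) * (p * p * h)          ∎)
          where
          shift : ∀ x y z → x * (y * z) ≡ y * (z * x)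
          shift = solve-∀
          swap : ∀ x y z → x * (y * z) ≡ y * (x * z)
          swap = solve-∀
          collect : ∀ p h s n → 2 * p * (8 * (p * p * p) * h * (s * n)) ≡ 16 * (n * s * (p * p)) * (p * p * h)
          collect = solve-∀
          each : ∀ w → h * ind (bad w) ≤ 2 * p * trace w
          each w with trace w ≤ᵇ d in eq
          ... | true  = ≤-trans (≤-reflexive (*-zeroʳ h)) z≤n
          ... | false = begin
            h * 1             ≡⟨ *-identityʳ h ⟩
            h                 ≤⟨ <⇒≤ <d+1 ⟩
            2 * p * suc d     ≤⟨ *-monoʳ-≤ (2 * p) (≰⇒> (subst T eq ∘ ≤⇒≤ᵇ)) ⟩
            2 * p * trace w   ∎

        -- The factor s p of 8 p³ s² is at most `n`, by `small`.
        card-A : card A ≤ 8 * (n * s * (p * p))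
        card-A = begin
          card A                       ≤⟨ A< ⟩
          8 * (p * p * p) * (s * s)    ≡⟨ regroup p s ⟩
          8 * (s * p * s * (p * p))    ≤⟨ *-monoʳ-≤ 8 (*-monoˡ-≤ (p * p) (*-monoˡ-≤ s small)) ⟩
          8 * (n * s * (p * p))        ∎
          where
          regroup : ∀ p s → 8 * (p * p * p) * (s * s) ≡ 8 * (s * p * s * (p * p))
          regroup = solve-∀

        -- Of at least 40 X vertices in `C`, at most 8 X lie in `A` and at most 16 X are bad; the 16
        -- X that are left number at least `n`.
        card-good : n ≤ card good
        card-good = +-cancelʳ-≤ (24 * X) n (card good) (begin
          n + 24 * X                                ≤⟨ +-monoˡ-≤ (24 * X) n≤16X ⟩
          16 * X + 24 * X                           ≡⟨ *-distribʳ-+ X 16 24 ⟨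
          40 * X                                    ≤⟨ many ⟩
          card C                                    ≤⟨ sum-+-≤ _ _ _ (λ w → cover (C w) (A w) (trace w ≤ᵇ d)) ⟩
          card good + sum (λ w → ind (A w) + ind (bad w))
            ≡⟨ cong (card good +_) (∑-distrib-+ (ind ∘ A) (ind ∘ bad)) ⟩
          card good + (card A + card bad)           ≤⟨ +-monoʳ-≤ (card good) (+-mono-≤ card-A card-bad) ⟩
          card good + (8 * X + 16 * X)              ≡⟨ cong (card good +_) (*-distribʳ-+ X 8 16) ⟨
          card good + 24 * X                        ∎)
          where
          X = n * s * (p * p)
          n≤16X : n ≤ 16 * X
          n≤16X = begin
            n            ≤⟨ m≤m*n n s ⟩
            n * s        ≤⟨ m≤m*n (n * s) (p * p) ⟩
            X            ≤⟨ m≤n*m X 16 ⟩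
            16 * X       ∎
          cover : ∀ c a t → ind c ≤ ind (c ∧ (not a ∧ t)) + (ind a + ind (not t))
          cover false a     t     = z≤n
          cover true  true  t     = s≤s z≤n
          cover true  false true  = s≤s z≤n
          cover true  false false = s≤s z≤n

        good⁻ : ∀ w → T (good w) → T (C w) × ¬ T (A w) × trace w ≤ d
        good⁻ w t =
          let Cw , t′ = ∧⁻ (C w) _ t
              ¬Aw , few = ∧⁻ (not (A w)) _ t′
          in Cw , not⁻ (A w) ¬Aw , ≤ᵇ⇒≤ _ _ few

        -- Makes the exchange a gain: at most `d` vertices leave and `h` enter. Otherwise d ≥ h > 0,
        -- and 2 p d would exceed `h`.
        d<h : d < h
        d<h = ≰⇒> λ h≤d → <⇒≱ (begin-strict
          d            <⟨ m<m+n d (≤-trans (>-nonZero⁻¹ h) h≤d) ⟩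
          d + d        ≡⟨ cong (d +_) (+-identityʳ d) ⟨
          2 * d        ≤⟨ *-monoˡ-≤ d (m≤m*n 2 p) ⟩
          2 * p * d    ≤⟨ d≤ ⟩
          h            ∎) h≤d

        -- The factor 5 in `large` is spent here: `h` on the 2^h vertices wanted and 4h on the
        -- number of traces.
        pigeons : 2 ^ h * choose≤ (card A) d ≤ card good
        pigeons = begin
          2 ^ h * choose≤ (card A) d                 ≤⟨ *-monoʳ-≤ (2 ^ h) (choose≤-mono d A<) ⟩
          2 ^ h * choose≤ (8 * (p * p * p) * h) d    ≤⟨ *-monoʳ-≤ (2 ^ h) (choose≤-2^ r h d d≤) ⟩
          2 ^ h * 2 ^ (4 * h)                        ≡⟨ ^-distribˡ-+-* 2 h (4 * h) ⟨
          2 ^ (5 * h)                                ≤⟨ large ⟩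
          n                                          ≤⟨ card-good ⟩
          card good                                  ∎

        exchange : ∃ λ A′ → A′ ⊆ C × Graded A′ h × card A < card A′
        exchange =
          let W , W⊆ , 2^h≤W , same = common-trace A nb d (2 ^ h) good (λ w → proj₂ ∘ proj₂ ∘ good⁻ w) pigeons
              -- All of `W` has the same trace on `A`, so one representative `w₀` determines the set
              -- to be removed.
              w₀ , Ww₀ = element W (≤-trans (m^n>0 2 h) 2^h≤W)
              B , B⊆W , grB , card-B = acyclic-subset h W 2^h≤W
              good-B w Bw = good⁻ w (W⊆ w (B⊆W w Bw))
              kept⁻ u = ∧⁻ (A u) (not (nb u w₀))
              few = ≤-<-trans (proj₂ (proj₂ (good⁻ w₀ (W⊆ w₀ Ww₀)))) d<h
          in A ∖ (λ u → nb u w₀) ∪ B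
           , (λ w → [ A⊆C w ∘ proj₁ ∘ kept⁻ w , proj₁ ∘ good-B w ]′ ∘ ∨⁻ _ (B w))
           , graded-∪ (graded-⊆ (λ u → proj₁ ∘ kept⁻ u) gr) grB
               -- A neighbour in `A` of a vertex of `B` is also a neighbour of `w₀`, hence was
               -- removed.
               (λ u w Ku Bw nb-uw → not⁻ (nb u w₀) (proj₂ (kept⁻ u Ku))
                 (subst T (same u (proj₁ (kept⁻ u Ku)) w w₀ (B⊆W w Bw) Ww₀) nb-uw))
           , card-exchange A (λ u → nb u w₀) B (λ w Bw → proj₁ (proj₂ (good-B w Bw)))
               (subst (trace w₀ <_) (sym card-B) few)

      gap : ∃ λ d → 2 * p * d ≤ h × h < 2 * p * suc d
      gap = bracket (2 * p *_) (suc h) (≤-trans (≤-reflexive (*-zeroʳ (2 * p))) z≤n)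
              (m≤n*m (suc h) (2 * p) {{m*n≢0 2 p}})

      enlarge : ∃ λ A′ → A′ ⊆ C × Graded A′ h × card A < card A′
      enlarge = let d , d≤ , <d+1 = gap in exchange d d≤ <d+1

    a : ℕ
    a = 8 * (p * p * p) * h

    graded-subset : ∀ j → j ≤ a → ∃ λ A → A ⊆ C × Graded A h × j ≤ card A
    graded-subset zero    _   = (λ _ → false) , (λ _ ()) , graded-∅ , z≤n
    graded-subset (suc j) j<a =
      let A , A⊆C , gr , j≤A = graded-subset j (<⇒≤ j<a) in
      -- Each exchange gains at least one vertex, so repetition reaches every size up to `a`.
      [ (λ A≤a → let A′ , A′⊆C , gr′ , A<A′ = enlarge A A⊆C gr A≤a in A′ , A′⊆C , gr′ , ≤-<-trans j≤A A<A′)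
      , (λ a≤A → A , A⊆C , gr , ≤-trans j<a a≤A) ]′ (≤-total (card A) a)

  -- Degree sums and greedy colouring

  degree-sum : sum (deg) ≤ 2 * edgeCount
  degree-sum = begin
    sum (deg)
      ≤⟨ sum-+-≤ _ out in′ (λ u → sum-+-≤ _ _ _ (λ v → ind-∨ (adj u v) (adj v u))) ⟩
    sum out + sum in′
      ≡⟨ cong (sum out +_) (∑-comm (λ u v → ind (adj v u))) ⟩
    sum out + sum out
      ≡⟨ cong₂ _+_ edges (trans edges (sym (+-identityʳ _))) ⟩
    2 * edgeCount ∎
    where
    out in′ : Vertex → ℕ
    out u = sum (λ v → ind (adj u v))
    in′ u = sum (λ v → ind (adj v u))
    ind-∨ : ∀ b c → ind (b ∨ c) ≤ ind b + ind c
    ind-∨ true  c = s≤s z≤n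
    ind-∨ false c = ≤-refl
    edges : sum out ≡ edgeCount
    edges = sym (length-filter-product (λ (u , v) → adj u v) (λ u → u) (λ v → v))

  -- Markov's inequality for the threshold t / c on the degree, with the division cleared.
  card-high : ∀ c t (P : VertexSet) → (∀ v → ¬ T (P v) → t ≤ c * deg v) →
    card ((λ _ → true) ∖ P) * t ≤ c * (2 * edgeCount)
  card-high c t P high = begin
    card ((λ _ → true) ∖ P) * t            ≡⟨ *-comm _ t ⟩
    t * card ((λ _ → true) ∖ P)            ≡⟨ *-distribˡ-sum t (ind ∘ ((λ _ → true) ∖ P)) ⟩
    sum (λ v → t * ind (not (P v)))        ≤⟨ sum-mono-≤ each ⟩
    sum (λ v → c * deg v)                ≡⟨ *-distribˡ-sum c (deg) ⟨
    c * sum (deg)                        ≤⟨ *-monoʳ-≤ c degree-sum ⟩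
    c * (2 * edgeCount)                    ∎
    where
    each : ∀ v → t * ind (not (P v)) ≤ c * deg v
    each v with P v | high v
    ... | true  | _  = ≤-trans (≤-reflexive (*-zeroʳ t)) z≤n
    ... | false | hi = ≤-trans (≤-reflexive (*-identityʳ t)) (hi λ ())

  Proper : ∀ {k} → VertexSet → (Vertex → Fin k) → Set
  Proper P c = ∀ u v → T (P u) → T (P v) → u ⟶ v → c u ≢ c v

  -- The numbers of neighbours of `v` in the single colours add up to its degree, which is below
  -- `k`, so one of them is 0.
  free-colour : ∀ {k} (c : Vertex → Fin k) v → deg v < k → ∃ λ j → ∀ u → T (nb v u) → j ≢ c u
  free-colour {k} c v deg<k =
    let j , unused = sum-<⇒∃0 used (≤-<-trans (≤-reflexive total) deg<k) in
    j , λ u nb-vu j≡cu → contradiction (≤-trans (present u nb-vu j≡cu) (term≤sum (uses j) u)) (<⇒≱ (s≤s (≤-reflexive unused)))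
    where
    uses : Fin k → Vertex → ℕ
    uses j u = ind (nb v u) * ind (does (j ≟ c u))
    used : Fin k → ℕ
    used j = sum (uses j)
    present : ∀ {j} u → T (nb v u) → j ≡ c u → 1 ≤ uses j u
    present u nb-vu refl with nb v u | c u ≟ c u
    ... | true | yes _   = s≤s z≤n
    ... | true | no  c≢c = contradiction refl c≢c
    total : sum used ≡ deg v
    total = trans (∑-comm uses) (sum-cong-≗ λ u →
      trans (sym (*-distribˡ-sum (ind (nb v u)) (λ j → ind (does (j ≟ c u)))))
        (trans (cong (ind (nb v u) *_) (sum-singleton (c u))) (*-identityʳ _)))

  recolour : ∀ {k} (c : Vertex → Fin k) P v j → Proper (P ∖ ⁅ v ⁆) c →
    (∀ u → T (nb v u) → j ≢ c u) → Proper P (λ u → if does (u ≟ v) then j else c u)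
  recolour c P v j proper free u w Pu Pw e
    with u ≟ v | w ≟ v | proper u w
  ... | yes refl | yes refl | _  = contradiction e (loopless refl)
  ... | yes refl | no  _    | _  = free w (∨⁺ˡ _ _ e)
  ... | no  _    | yes refl | _  = free u (∨⁺ʳ (adj w u) _ e) ∘ sym
  ... | no  _    | no  _    | pr = pr (∧⁺ _ _ Pu _) (∧⁺ _ _ Pw _) e

  -- One vertex is set aside, the others are coloured, and the degree bound leaves a colour for it.
  -- The recursion is on `f`, a bound for the number of vertices still to be coloured.
  greedy : ∀ k f (P : VertexSet) → card P ≤ f → (∀ v → T (P v) → deg v < suc k) → ∃ (Proper {suc k} P)
  greedy k f P P≤f low with 0 <? card P
  ... | no ∅ = (λ _ → zero) , λ u _ Pu → contradiction
    (≤-trans (≤-reflexive (sym (ind-T Pu))) (term≤sum (ind ∘ P) u)) ∅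
  greedy k zero    P P≤f low | yes 0<P = contradiction P≤f (<⇒≱ 0<P)
  greedy k (suc f) P P≤f low | yes 0<P =
    let v , Pv = element P 0<P
        c , proper = greedy k f (P ∖ ⁅ v ⁆) (s≤s⁻¹ (≤-trans (≤-reflexive (sym (size v Pv))) P≤f))
                       (λ u → low u ∘ proj₁ ∘ ∧⁻ (P u) _)
        j , free = free-colour c v (low v Pv)
    in _ , recolour c P v j proper free
    where
    ⁅⁆⊆ : ∀ v → T (P v) → ⁅ v ⁆ ⊆ P
    ⁅⁆⊆ v Pv w t with w ≟ v
    ... | yes refl = Pv
    size : ∀ v → T (P v) → card P ≡ suc (card (P ∖ ⁅ v ⁆))
    size v Pv = trans (card-∖ P ⁅ v ⁆ (⁅⁆⊆ v Pv)) (cong (_+ card (P ∖ ⁅ v ⁆)) (sum-singleton v))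

  -- One coordinate follows the colours and the other runs through them backwards, so an edge
  -- between different colours raises one of the two.
  proper⇒layout : ∀ {P k} (c : Vertex → Fin (suc k)) → Proper P c → Layout P (suc k)
  proper⇒layout {P} {k} c proper = record
    { x     = λ v → toℕ (c v)
    ; y     = λ v → k ∸ toℕ (c v)
    ; x<    = λ v _ → toℕ<n (c v)
    ; y<    = λ v _ → s≤s (m∸n≤m k (toℕ (c v)))
    ; rises = rises
    }
    where
    rises : ∀ u v → T (P u) → T (P v) → u ⟶ v → toℕ (c u) < toℕ (c v) ⊎ k ∸ toℕ (c u) < k ∸ toℕ (c v)
    rises u v Pu Pv e with <-cmp (toℕ (c u)) (toℕ (c v))
    ... | tri< lt _ _ = inj₁ lt
    ... | tri≈ _ eq _ = contradiction (toℕ-injective eq) (proper u v Pu Pv e)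
    ... | tri> _ _ gt = inj₂ (∸-monoʳ-< gt (s≤s⁻¹ (toℕ<n (c u))))

  low-degree-layout : ∀ n .{{_ : NonZero n}} (P : VertexSet) → (∀ v → T (P v) → deg v < n) → Layout P n
  low-degree-layout (suc k) P low = let c , proper = greedy k (card P) P ≤-refl low in proper⇒layout c proper

  -- Exhausting a set by classes

  Supply : (s a M : ℕ) → VertexSet → Set
  Supply s a M Q = ∀ C → C ⊆ Q → M ≤ card C → ∃ λ A → A ⊆ C × Graded A (s * s) × a ≤ card A

  -- Classes are taken as long as `M` vertices are left, and `R` is what remains. Every class costs
  -- `s` and uses up at least `a` vertices, so the total cost is at most s / a per vertex; `f`
  -- bounds the number of rounds.
  exhaust : ∀ s .{{_ : NonZero s}} a .{{_ : NonZero a}} M Q → Supply s a M Q →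
    ∀ f C → card C ≤ f → C ⊆ Q →
    ∃₂ λ R b → R ⊆ C × card R < M × Layout (C ∖ R) b × a * b ≤ s * card C
  exhaust s a M Q supply f C C≤f C⊆Q with M ≤? card C
  ... | no M≰C = C , 0 , (λ _ t → t) , ≰⇒> M≰C ,
    layout-∅ (λ v t → let Cv , ¬Cv = ∧⁻ (C v) _ t in not⁻ _ ¬Cv Cv) ,
    ≤-trans (≤-reflexive (*-zeroʳ a)) z≤n
  exhaust s a M Q supply zero C C≤f C⊆Q | yes M≤C =
    let A , A⊆C , _ , a≤A = supply C C⊆Q M≤C
    in contradiction (≤-trans a≤A (≤-trans (card-mono A C A⊆C) C≤f)) (<⇒≱ (>-nonZero⁻¹ a))
  exhaust s a M Q supply (suc f) C C≤f C⊆Q | yes M≤C =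
    let A , A⊆C , gr , a≤A = supply C C⊆Q M≤C
        size = card-∖ C A A⊆C
        shorter = s≤s⁻¹ (≤-trans (+-monoˡ-≤ (card (C ∖ A)) (≤-trans (>-nonZero⁻¹ a) a≤A))
                    (≤-trans (≤-reflexive (sym size)) C≤f))
        R , b , R⊆ , R<M , L , cost = exhaust s a M Q supply f (C ∖ A) shorter
                                        (λ v → C⊆Q v ∘ proj₁ ∘ ∧⁻ (C v) _)
    in R , s + b , (λ v → proj₁ ∘ ∧⁻ (C v) _ ∘ R⊆ v) , R<M ,
       layout-⊆ (cover C A R) (layout-∪ (graded⇒layout s gr) L) ,
       (begin
         a * (s + b)                      ≡⟨ *-distribˡ-+ a s b ⟩
         a * s + a * b                    ≤⟨ +-mono-≤ (*-monoˡ-≤ s a≤A) cost ⟩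
         card A * s + s * card (C ∖ A)    ≡⟨ cong (_+ s * card (C ∖ A)) (*-comm (card A) s) ⟩
         s * card A + s * card (C ∖ A)    ≡⟨ *-distribˡ-+ s (card A) _ ⟨
         s * (card A + card (C ∖ A))      ≡⟨ cong (s *_) size ⟨
         s * card C                       ∎)
    where
    cover : ∀ C A R → C ∖ R ⊆ A ∪ (C ∖ A) ∖ R
    cover C A R v t with C v | A v | R v
    ... | true | true  | _     = _
    ... | true | false | false = _

  -- Since `D` keeps its layout, only the vertices of `Q` outside `D` are charged.
  layer : ∀ s .{{_ : NonZero s}} a .{{_ : NonZero a}} M Q D {b} → Supply s a M Q → Layout D b →
    ∃₂ λ R c → R ⊆ Q × card R < M × Layout (Q ∖ R) (b + c) × a * c ≤ s * card (Q ∖ D)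
  layer s a M Q D supply L =
    let Q∖D⊆Q v = proj₁ ∘ ∧⁻ (Q v) (not (D v))
        R , c , R⊆ , R<M , L′ , cost = exhaust s a M Q supply _ (Q ∖ D) ≤-refl Q∖D⊆Q
    in R , c , (λ v → Q∖D⊆Q v ∘ R⊆ v) , R<M , layout-⊆ (cover R) (layout-∪ L L′) , cost
    where
    cover : ∀ R → Q ∖ R ⊆ D ∪ (Q ∖ D) ∖ R
    cover R v t with Q v | D v | R v
    ... | true | true  | _     = _
    ... | true | false | false = _

  all : VertexSet
  all _ = true

  singletons : Supply 1 1 1 all
  singletons C _ 0<C =
    let v , Cv = element C 0<C in ⁅ v ⁆ , ⊆C v Cv , graded v , ≤-reflexive (sym (sum-singleton v))
    where
    ⊆C : ∀ v → T (C v) → ⁅ v ⁆ ⊆ C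
    ⊆C v Cv w t with w ≟ v
    ... | yes refl = Cv
    graded : ∀ v → Graded ⁅ v ⁆ 1
    graded v = record { level = λ _ → 0 ; level< = λ _ _ → s≤s z≤n ; rises = rises }
      where
      rises : ∀ u w → T (⁅ v ⁆ u) → T (⁅ v ⁆ w) → u ⟶ w → 0 < 0
      rises u w tu tw e with u ≟ v | w ≟ v
      ... | yes refl | yes refl = contradiction e (loopless refl)

  -- Vertices outside `D` become classes of their own; with `M` equal to 1 the remainder `R` is
  -- empty.
  complete : ∀ D {b} → Layout D b → ∃ λ c → c ≤ card (all ∖ D) × Layout all (b + c)
  complete D L =
    let R , c , _ , R<1 , L′ , cost = layer 1 1 1 all D singletons L in
    c , ≤-trans (≤-reflexive (sym (*-identityˡ c))) (≤-trans cost (≤-reflexive (*-identityˡ _))) ,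
    layout-⊆ (λ v _ → not⁺ (R v) λ Rv → contradiction
      (≤-trans (≤-reflexive (sym (ind-T Rv))) (term≤sum (ind ∘ R) v)) (<⇒≱ R<1)) L′

  -- Layers by degree threshold

  module Assembly (n s : ℕ) .{{_ : NonZero n}} .{{_ : NonZero s}}
    (large : 2 ^ (5 * (s * s)) ≤ n) (few : edgeCount ≤ 20 * (n * n * (s * s))) where

    h : ℕ
    h = s * s

    instance
      h≢0 : NonZero h
      h≢0 = m*n≢0 s s
      sn≢0 : NonZero (s * n)
      sn≢0 = m*n≢0 s n

    low : ℕ → VertexSet
    low r v = 2 ^ r * 2 ^ r * deg v <ᵇ s * n

    low⁻ : ∀ r v → T (low r v) → 2 ^ r * 2 ^ r * deg v < s * n
    low⁻ r v = <ᵇ⇒< _ _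

    -- Bounds the number of vertices above threshold `r`, and is also the number of vertices from
    -- which the exchange argument yields a class.
    capacity : ℕ → ℕ
    capacity r = 40 * (n * s * (2 ^ r * 2 ^ r))

    -- The degrees add up to at most 40 n² s², and each vertex counted contributes at least s n /
    -- 4^r.
    card-not-low : ∀ r → card (all ∖ low r) ≤ capacity r
    card-not-low r = *-cancelʳ-≤ _ _ (s * n) (begin
      card (all ∖ low r) * (s * n)
        ≤⟨ card-high (2 ^ r * 2 ^ r) (s * n) (low r) (λ v ¬low → ≮⇒≥ (¬low ∘ <⇒<ᵇ)) ⟩
      2 ^ r * 2 ^ r * (2 * edgeCount)
        ≤⟨ *-monoʳ-≤ (2 ^ r * 2 ^ r) (*-monoʳ-≤ 2 few) ⟩
      2 ^ r * 2 ^ r * (2 * (20 * (n * n * (s * s))))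
        ≡⟨ regroup (2 ^ r) n s ⟩
      capacity r * (s * n) ∎)
      where
      regroup : ∀ p n s → p * p * (2 * (20 * (n * n * (s * s)))) ≡ 40 * (n * s * (p * p)) * (s * n)
      regroup = solve-∀

    uncovered : ∀ Q r (R : VertexSet) → card R ≤ capacity r →
      card (Q ∖ (low r ∖ R)) ≤ capacity r + capacity r
    uncovered Q r R R≤ = ≤-trans
      (sum-+-≤ _ (ind ∘ (all ∖ low r)) (ind ∘ R) (λ v → cover (Q v) (low r v) (R v)))
      (+-mono-≤ (card-not-low r) R≤)
      where
      cover : ∀ q l x → ind (q ∧ not (l ∧ not x)) ≤ ind (not l) + ind x
      cover false l     x     = z≤n
      cover true  false x     = s≤s z≤n
      cover true  true  false = z≤n
      cover true  true  true  = s≤s z≤n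

    -- The layers r, …, s cost b in total on top of the n colours used for the
    -- vertices of degree below n.
    record Stage (r : ℕ) : Set where
      field
        rest   : VertexSet
        b      : ℕ
        small  : card rest ≤ capacity r
        layout : Layout (low r ∖ rest) (n + b)
        cost   : 2 ^ r * b ≤ 80 * n

    -- At `r` equal to `s` the threshold s n / 4^s is at most `n`, because s ≤ 4^s; so `n`
    -- independent sets suffice.
    first : Stage s
    first = record
      { rest   = λ _ → false
      ; b      = 0
      ; small  = ≤-trans (≤-reflexive (sum-zero order)) z≤n
      ; layout = subst (Layout (low s ∖ (λ _ → false))) (sym (+-identityʳ n))
                   (low-degree-layout n _ λ v t → degree< v (low⁻ s v (proj₁ (∧⁻ (low s v) true t))))
      ; cost   = ≤-trans (≤-reflexive (*-zeroʳ (2 ^ s))) z≤n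
      }
      where
      degree< : ∀ v → 2 ^ s * 2 ^ s * deg v < s * n → deg v < n
      degree< v lt = *-cancelˡ-< s _ _ (≤-<-trans (*-monoˡ-≤ (deg v) s≤) lt)
        where
        s≤ : s ≤ 2 ^ s * 2 ^ s
        s≤ = ≤-trans (<⇒≤ (n<2^n s)) (m≤m*n (2 ^ s) (2 ^ s) {{m^n≢0 2 s}})

    supply : ∀ r → r ≤ s → Supply s (8 * (2 ^ r * 2 ^ r * 2 ^ r) * h) (capacity r) (low r)
    supply r r≤s C C⊆ many = Exchange.graded-subset n s r small large C (λ v Cv → <⇒≤ (low⁻ r v (C⊆ v Cv))) many _ ≤-refl
      where
      small : s * 2 ^ r ≤ n
      small = begin
        s * 2 ^ r          ≤⟨ *-mono-≤ (<⇒≤ (n<2^n s)) (^-monoʳ-≤ 2 r≤s) ⟩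
        2 ^ s * 2 ^ s      ≡⟨ ^-distribˡ-+-* 2 s s ⟨
        2 ^ (s + s)        ≤⟨ ^-monoʳ-≤ 2 (+-mono-≤ (m≤m*n s s) (≤-trans (m≤m*n s s) (m≤n*m h 4))) ⟩
        2 ^ (h + 4 * h)    ≤⟨ large ⟩
        n                  ∎

    -- The old layers cost at most 80 n / 2^(r + 1) = 40 n / 2^r. The new one handles at most 2 · 40
    -- n s 4^(r + 1) vertices in classes of at least 8 · 8^r s² at cost `s` each, which is again at
    -- most 40 n / 2^r.
    next : ∀ r → suc r ≤ s → Stage (suc r) → Stage r
    next r r<s stage =
      let R , c , _ , R< , L , cost′ = layer s (8 * (p * p * p) * h) (capacity r) (low r) (low (suc r) ∖ rest)
                                         (supply r (<⇒≤ r<s)) layout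
      in record
        { rest   = R
        ; b      = b + c
        ; small  = <⇒≤ R<
        ; layout = subst (Layout (low r ∖ R)) (+-assoc n b c) L
        ; cost   = total c cost′
        }
      where
      open Stage stage
      p : ℕ
      p = 2 ^ r
      instance
        p≢0 : NonZero p
        p≢0 = m^n≢0 2 r
        pp≢0 : NonZero (p * p)
        pp≢0 = m*n≢0 p p
        ppp≢0 : NonZero (p * p * p)
        ppp≢0 = m*n≢0 (p * p) p
        8ppp≢0 : NonZero (8 * (p * p * p))
        8ppp≢0 = m*n≢0 8 (p * p * p)
        a≢0 : NonZero (8 * (p * p * p) * h)
        a≢0 = m*n≢0 (8 * (p * p * p)) h
        8pph≢0 : NonZero (8 * (p * p) * h)
        8pph≢0 = m*n≢0 (8 * (p * p)) h {{m*n≢0 8 (p * p)}}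
      new : ∀ c → 8 * (p * p * p) * h * c ≤ s * card (low r ∖ (low (suc r) ∖ rest)) → p * c ≤ 40 * n
      new c cost′ = *-cancelˡ-≤ (8 * (p * p) * h) (begin
        8 * (p * p) * h * (p * c)       ≡⟨ regroup₁ p h c ⟩
        8 * (p * p * p) * h * c         ≤⟨ cost′ ⟩
        s * card (low r ∖ (low (suc r) ∖ rest))
                                        ≤⟨ *-monoʳ-≤ s (uncovered (low r) (suc r) rest small) ⟩
        s * (capacity (suc r) + capacity (suc r))
                                        ≡⟨ regroup₂ s n p ⟩
        8 * (p * p) * h * (40 * n)      ∎)
        where
        regroup₁ : ∀ p h c → 8 * (p * p) * h * (p * c) ≡ 8 * (p * p * p) * h * c
        regroup₁ = solve-∀
        regroup₂ : ∀ s n p → s * (40 * (n * s * (2 * p * (2 * p))) + 40 * (n * s * (2 * p * (2 * p)))) ≡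
                             8 * (p * p) * (s * s) * (40 * n)
        regroup₂ = solve-∀
      total : ∀ c → 8 * (p * p * p) * h * c ≤ s * card (low r ∖ (low (suc r) ∖ rest)) → p * (b + c) ≤ 80 * n
      total c cost′ = begin
        p * (b + c)         ≡⟨ *-distribˡ-+ p b c ⟩
        p * b + p * c       ≤⟨ +-mono-≤ old (new c cost′) ⟩
        40 * n + 40 * n     ≡⟨ *-distribʳ-+ n 40 40 ⟨
        80 * n              ∎
        where
        old : p * b ≤ 40 * n
        old = *-cancelˡ-≤ 2 (≤-trans (≤-reflexive (sym (*-assoc 2 p b)))
                (≤-trans cost (≤-reflexive (*-assoc 2 40 n))))

    stage : ∀ j r → j + r ≡ s → Stage r
    stage zero    r refl = first
    stage (suc j) r eq   = next r (subst (suc r ≤_) eq (s≤s (m≤n+m r j))) (stage j (suc r) (trans (+-suc j r) eq))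

    -- The terms of 162 n are `n` for the low degrees, 80 n for the stages down to 0, 80 n for
    -- acyclic classes of s² vertices among those not yet covered, and `n` for singletons, since
    -- fewer than 2^h ≤ n vertices are then left.
    layout-all : ∃ λ b → b ≤ 162 * n × Layout (all) b
    layout-all =
      let R , c , _ , R< , L , cost′ = layer s h (2 ^ h) (all) (low 0 ∖ rest) top layout
          e , e≤ , L′ = complete (all ∖ R) L
      in n + b + c + e , bound c e (last c cost′) (≤-trans e≤ (leftover R R<)) , L′
      where
      open Stage (stage s 0 (+-identityʳ s))
      top : Supply s h (2 ^ h) (all)
      top C _ 2^h≤C = let A , A⊆C , gr , eq = acyclic-subset h C 2^h≤C in A , A⊆C , gr , ≤-reflexive (sym eq)
      last : ∀ c → h * c ≤ s * card (all ∖ (low 0 ∖ rest)) → c ≤ 80 * n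
      last c cost′ = *-cancelˡ-≤ h (begin
        h * c                                  ≤⟨ cost′ ⟩
        s * card (all ∖ (low 0 ∖ rest))      ≤⟨ *-monoʳ-≤ s (uncovered (all) 0 rest small) ⟩
        s * (capacity 0 + capacity 0)          ≡⟨ regroup s n ⟩
        h * (80 * n)                           ∎)
        where
        regroup : ∀ s n → s * (40 * (n * s * 1) + 40 * (n * s * 1)) ≡ s * s * (80 * n)
        regroup = solve-∀
      leftover : ∀ R → card R < 2 ^ h → card (all ∖ (all ∖ R)) ≤ n
      leftover R R< = begin
        card (all ∖ (all ∖ R))  ≡⟨ sum-cong-≗ (λ v → not-not (R v)) ⟩
        card R                      ≤⟨ <⇒≤ R< ⟩
        2 ^ h                       ≤⟨ ^-monoʳ-≤ 2 (m≤n*m h 5) ⟩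
        2 ^ (5 * h)                 ≤⟨ large ⟩
        n                           ∎
        where
        not-not : ∀ x → ind (not (not x)) ≡ ind x
        not-not true  = refl
        not-not false = refl
      bound : ∀ c e → c ≤ 80 * n → e ≤ n → n + b + c + e ≤ 162 * n
      bound c e c≤ e≤ = begin
        n + b + c + e                ≤⟨ +-mono-≤ (+-mono-≤ (+-monoʳ-≤ n b≤) c≤) e≤ ⟩
        n + 80 * n + 80 * n + n      ≡⟨ regroup n ⟩
        162 * n                      ∎
        where
        b≤ : b ≤ 80 * n
        b≤ = ≤-trans (≤-reflexive (sym (*-identityˡ b))) cost
        regroup : ∀ n → n + 80 * n + 80 * n + n ≡ 162 * n
        regroup = solve-∀

  -- Every vertex of degree at least n forms a class of its own.
  layout-few-edges : ∀ n .{{_ : NonZero n}} → edgeCount ≤ 5 * (n * n) → ∃ λ b → b ≤ 162 * n × Layout (all) b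
  layout-few-edges n few =
    let c , c≤ , L = complete low (low-degree-layout n low (λ v → <ᵇ⇒< _ _)) in
    n + c , bound c (≤-trans c≤ high) , L
    where
    low : VertexSet
    low v = deg v <ᵇ n
    high : card (all ∖ low) ≤ 10 * n
    high = *-cancelʳ-≤ _ _ n (begin
      card (all ∖ low) * n
        ≤⟨ card-high 1 n low (λ v ¬low → ≤-trans (≮⇒≥ (¬low ∘ <⇒<ᵇ)) (≤-reflexive (sym (*-identityˡ _)))) ⟩
      1 * (2 * edgeCount)         ≤⟨ *-monoʳ-≤ 1 (*-monoʳ-≤ 2 few) ⟩
      1 * (2 * (5 * (n * n)))     ≡⟨ regroup n ⟩
      10 * n * n                  ∎)
      where
      regroup : ∀ n → 1 * (2 * (5 * (n * n))) ≡ 10 * n * n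
      regroup = solve-∀
    bound : ∀ c → c ≤ 10 * n → n + c ≤ 162 * n
    bound c c≤ = ≤-trans (+-monoʳ-≤ n c≤) (*-monoˡ-≤ n {11} {162} (≤ᵇ⇒≤ 11 162 _))

-- Choice of the parameters and conclusion

edge-bound : ∀ n .{{_ : NonZero n}} k m → m ≤ n ^ 2 ·log₂ n → n < 2 ^ suc k → m ≤ suc k * (n * n)
edge-bound n k m 2^m≤ n< = subst (λ t → m ≤ suc k * t) (cong (n *_) (*-identityʳ n)) (2^-cancel-≤ (begin
  2 ^ m                    ≤⟨ 2^m≤ ⟩
  n ^ (n ^ 2)              ≤⟨ ^-monoˡ-≤ (n ^ 2) (<⇒≤ n<) ⟩
  (2 ^ suc k) ^ (n ^ 2)    ≡⟨ ^-*-assoc 2 (suc k) (n ^ 2) ⟩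
  2 ^ (suc k * n ^ 2)      ∎))

layout-exists : ∀ n .{{_ : NonZero n}} (G : OrientedGraph) → OrientedGraph.edgeCount G ≤ n ^ 2 ·log₂ n →
  ∃ λ b → b ≤ 162 * n × Layout G (all G) b
layout-exists n G few =
  -- `k` is the integer part of log n, and `s` that of the square root of k / 5.
  let k , 2^k≤n , n<2^k+1 = bracket (2 ^_) n (>-nonZero⁻¹ n) (n<2^n n)
      s , 5ss≤k , k<      = bracket (λ s → 5 * (s * s)) {k} (suc k) z≤n
                              (≤-trans (m≤m*n (suc k) (suc k)) (m≤n*m (suc k * suc k) 5))
  in by-size s k 2^k≤n 5ss≤k k< (edge-bound n k _ few n<2^k+1)
  where
  open OrientedGraph G using (edgeCount)
  by-size : ∀ s k → 2 ^ k ≤ n → 5 * (s * s) ≤ k → k < 5 * (suc s * suc s) → edgeCount ≤ suc k * (n * n) →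
    ∃ λ b → b ≤ 162 * n × Layout G (all G) b
  -- Here k < 5, so there are at most 5 n² edges.
  by-size zero      k 2^k≤n 5ss≤k k< few = layout-few-edges G n (≤-trans few (*-monoˡ-≤ (n * n) k<))
  by-size s@(suc t) k 2^k≤n 5ss≤k k< few =
    -- The 20 arises from k + 1 ≤ 5 (s + 1)² ≤ 5 (2s)², as s ≥ 1.
    Assembly.layout-all G n s (≤-trans (^-monoʳ-≤ 2 5ss≤k) 2^k≤n) (begin
      edgeCount                                  ≤⟨ few ⟩
      suc k * (n * n)                            ≤⟨ *-monoˡ-≤ (n * n) k< ⟩
      5 * (suc s * suc s) * (n * n)              ≤⟨ *-monoˡ-≤ (n * n) (*-monoʳ-≤ 5 (*-mono-≤ double double)) ⟩
      5 * ((s + s) * (s + s)) * (n * n)          ≡⟨ regroup n s ⟩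
      20 * (n * n * (s * s))                     ∎)
    where
    double : suc s ≤ s + s
    double = +-monoˡ-≤ s (s≤s (z≤n {t}))
    regroup : ∀ n s → 5 * ((s + s) * (s + s)) * (n * n) ≡ 20 * (n * n * (s * s))
    regroup = solve-∀

theorem1 : (n : ℕ) → .{{_ : NonZero n}} → (G : OrientedGraph) →
    OrientedGraph.edgeCount G ≤ n ^ 2 ·log₂ n →
    Σ (EdgeColouring G 2) λ χ →
    ∀ {ℓ} (P : DirectedPath G ℓ) → Monochromatic G χ P → ℓ ≤ 169 * n
theorem1 n G few =
  let b , b≤ , L = layout-exists n G few
      χ , short  = layout⇒colouring G L
  in χ , λ P mono → ≤-trans (<⇒≤ (short P mono)) (≤-trans b≤ (*-monoˡ-≤ n {162} {169} (≤ᵇ⇒≤ 162 169 _)))
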